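{- Let $n\ge1$, $1\le M\le 2^{n-1}$, $a:=M/2^n$, and let $f:\{ -1,1\}^n\to\{ -1,1\}$ satisfy $|f^{ -1}(1)|=M$. For every even $m$ with $2\le m\le n$, $\mathbf{W}_m\le 4a(1-a)$. For every odd $m$ with $3\le m\le n$, $\mathbf{W}_m\le 2a$.
   Context: For $f:\{ -1,1\}^n\to\{ -1,1\}$ and $S\subseteq[1:n]$, the Fourier coefficient is $\hat f_S:=\mathbb{E}_{\mathbf{x}\sim\mathrm{Unif}\{ -1,1\}^n}[f(\mathbf{x})\prod_{i\in S}x_i]$, and the degree-$m$ Fourier weight is $\mathbf{W}_m:=\sum_{S:|S|=m}\hat f_S^{2}$. -}

module Defs where

open import Data.Bool.Base using (true; false)
open import Data.Fin.Subset using (Subset; ∣_∣)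
open import Data.Fin.Subset.Properties using (_∈?_)
open import Data.Integer.Base using (ℤ; +_)
open import Data.List.Base
  using (List; []; _∷_; map; filter; foldr; length; allFin; cartesianProductWith)
open import Data.List.Membership.Propositional using (_∈_)
open import Data.List.Membership.Propositional.Properties
  using (∈-cartesianProductWith⁺)
open import Data.List.Relation.Unary.All as All using ()
open import Data.List.Relation.Unary.AllPairs using ([]; _∷_)
open import Data.List.Relation.Unary.Any using (here; there)
open import Data.List.Relation.Unary.Unique.Propositional using (Unique)
open import Data.List.Relation.Unary.Unique.Propositional.Properties
  using (cartesianProductWith⁺)
open import Data.Nat.Base using (ℕ; zero; suc; _^_)
open import Data.Nat.Properties as ℕ using (m^n≢0)
open import Data.Rational.Base as ℚ using (ℚ; 0ℚ; 1ℚ; _/_)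
open import Data.Sign.Base using (Sign)
open import Data.Sign.Properties using (_≟_)
open import Data.Vec.Base as Vec using (Vec; lookup)
open import Data.Vec.Properties using (∷-injective)
open import Relation.Binary.PropositionalEquality using (_≡_; refl)

infixl 7 _/2^_

_/2^_ : ℤ → ℕ → ℚ
i /2^ n = _/_ i (2 ^ n) {{m^n≢0 2 n}}

vectors : {A : Set} → List A → ∀ n → List (Vec A n)
vectors as zero    = Vec.[] ∷ []
vectors as (suc n) = cartesianProductWith Vec._∷_ as (vectors as n)

vectors-complete : {A : Set} {as : List A} → (∀ a → a ∈ as) →
                   ∀ {n} (v : Vec A n) → v ∈ vectors as n
vectors-complete all Vec.[]       = here refl
vectors-complete all (a Vec.∷ v) =
  ∈-cartesianProductWith⁺ Vec._∷_ (all a) (vectors-complete all v)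

vectors-unique : {A : Set} {as : List A} → Unique as →
                 ∀ n → Unique (vectors as n)
vectors-unique as! zero    = All.[] ∷ []
vectors-unique as! (suc n) =
  cartesianProductWith⁺ Vec._∷_ ∷-injective as! (vectors-unique as! n)

-- The points of {-1,1}ⁿ, where Sign plays the role of {-1,1}.
cube : ∀ n → List (Vec Sign n)
cube = vectors (Sign.+ ∷ Sign.- ∷ [])

cube-complete : ∀ {n} (x : Vec Sign n) → x ∈ cube n
cube-complete = vectors-complete λ where
  Sign.+ → here refl
  Sign.- → there (here refl)

cube-unique : ∀ n → Unique (cube n)
cube-unique = vectors-unique (((λ ()) All.∷ All.[]) ∷ All.[] ∷ [])

subsets : ∀ n → List (Subset n)
subsets = vectors (true ∷ false ∷ [])

subsets-complete : ∀ {n} (S : Subset n) → S ∈ subsets n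
subsets-complete = vectors-complete λ where
  true  → here refl
  false → there (here refl)

subsets-unique : ∀ n → Unique (subsets n)
subsets-unique = vectors-unique (((λ ()) All.∷ All.[]) ∷ All.[] ∷ [])

sum : List ℚ → ℚ
sum = foldr ℚ._+_ 0ℚ

product : List ℚ → ℚ
product = foldr ℚ._*_ 1ℚ

⟦_⟧ : Sign → ℚ
⟦ Sign.+ ⟧ = 1ℚ
⟦ Sign.- ⟧ = ℚ.- 1ℚ

-- Expectation under the uniform distribution on {-1,1}ⁿ.
𝔼 : ∀ {n} → (Vec Sign n → ℚ) → ℚ
𝔼 {n} g = (+ 1 /2^ n) ℚ.* sum (map g (cube n))

-- ∏_{i ∈ S} xᵢ
χ : ∀ {n} → Subset n → Vec Sign n → ℚ
χ {n} S x = product (map (λ i → ⟦ lookup x i ⟧) (filter (_∈? S) (allFin n)))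

-- The coefficients are averages of ±1 over 2ⁿ points, so they lie in ℚ.
fourier : ∀ {n} → (Vec Sign n → Sign) → Subset n → ℚ
fourier f S = 𝔼 λ x → ⟦ f x ⟧ ℚ.* χ S x

W : ∀ {n} → ℕ → (Vec Sign n → Sign) → ℚ
W {n} m f =
  sum (map (λ S → fourier f S ℚ.* fourier f S)
           (filter (λ S → ∣ S ∣ ℕ.≟ m) (subsets n)))

∣_⁻¹⟨1⟩∣ : ∀ {n} → (Vec Sign n → Sign) → ℕ
∣_⁻¹⟨1⟩∣ {n} f = length (filter (λ x → f x ≟ Sign.+) (cube n))

{-# OPTIONS --safe #-}

-- For |S| ≥ 1 each bound is Bessel's inequality for a suitable function.
-- Even m: the weight of f at ∅ is (𝔼 f)² = (2a - 1)², which leaves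
-- 1 - (2a - 1)² = 4a(1 - a) for all the other coefficients together.
-- Odd m: if |S| is odd, then h(x) = f(x) - f(-x) has Ŝ-coefficient 2 f̂_S, and
-- h² ≤ 2((1 + f(x)) + (1 + f(-x))) pointwise, whence 4 W_m ≤ 𝔼 h² ≤ 8a.
module Submission where

open import Defs
open import Data.Bool.Base using (true; false)
open import Data.Fin.Base using (zero; suc)
open import Data.Fin.Subset using (Subset; ∣_∣; ⊥)
open import Data.Fin.Subset.Properties using (_∈?_; ∣⊥∣≡0)
open import Data.Integer.Base as ℤ using (+_)
import Data.Integer.Properties as ℤ
open import Data.List.Base using ([]; _∷_; _++_; map; filter; length; allFin; tabulate)
open import Data.List.Membership.Propositional using (_∈_)
open import Data.List.Properties using (map-tabulate; map-∘; ++-identityʳ)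
open import Data.List.Relation.Unary.Any using (here; there)
open import Data.Nat.Base as ℕ using (ℕ; zero; suc; _^_; _∸_)
open import Data.Nat.Divisibility using (_∣_; ∣m∣n⇒∣m+n; ∣-refl; _∣0)
import Data.Nat.Properties as ℕ
open import Data.Product.Base using (_×_; _,_)
open import Data.Rational.Base
  using (ℚ; 0ℚ; 1ℚ; ½; _/_; _+_; _*_; _-_; -_; _≤_; fromℚᵘ; nonNegative; nonPositive)
open import Data.Rational.Properties as ℚ
  using (≤-refl; ≤-trans; ≤-reflexive; +-mono-≤; module ≤-Reasoning)
open import Data.Rational.Solver using (module +-*-Solver)
open import Data.Rational.Unnormalised.Base as ℚᵘ using (mkℚᵘ; *≡*)
import Data.Rational.Unnormalised.Properties as ℚᵘ
open import Data.Sign.Base using (Sign; opposite)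
open import Data.Sign.Properties using (_≟_)
open import Data.Vec.Base as Vec using (Vec; lookup)
open import Data.Sum.Base using (inj₁; inj₂)
open import Function.Base using (_∘_; id)
open import Relation.Binary.PropositionalEquality
  using (_≡_; _≢_; refl; sym; trans; cong; cong₂; subst; module ≡-Reasoning)
open import Relation.Nullary.Decidable.Core using (yes; no)
open import Relation.Nullary.Negation.Core using (¬_; contradiction)
open import Relation.Unary using (Decidable)

open +-*-Solver using (solve; con; _:+_; _:*_; _:-_; :-_; _:=_)

private
  variable
    A : Set
    n : ℕ

-- Rational arithmetic and dyadic fractions.

2ℚ : ℚ
2ℚ = + 2 / 1

4ℚ : ℚ
4ℚ = + 4 / 1

-- Normalisation by gcd hides the product on the left, so the equation is checked after `toℚᵘ`,
-- which is injective, respects products, and undoes `fromℚᵘ` up to equivalence.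
fromℚᵘ-homo-* : ∀ p q → fromℚᵘ (p ℚᵘ.* q) ≡ fromℚᵘ p * fromℚᵘ q
fromℚᵘ-homo-* p q = ℚ.toℚᵘ-injective (ℚᵘ.≃-trans (ℚ.toℚᵘ-fromℚᵘ (p ℚᵘ.* q))
  (ℚᵘ.≃-sym (ℚᵘ.≃-trans (ℚ.toℚᵘ-homo-* (fromℚᵘ p) (fromℚᵘ q))
    (ℚᵘ.*-cong (ℚ.toℚᵘ-fromℚᵘ p) (ℚ.toℚᵘ-fromℚᵘ q)))))

fromℚᵘ-homo-+ : ∀ p q → fromℚᵘ (p ℚᵘ.+ q) ≡ fromℚᵘ p + fromℚᵘ q
fromℚᵘ-homo-+ p q = ℚ.toℚᵘ-injective (ℚᵘ.≃-trans (ℚ.toℚᵘ-fromℚᵘ (p ℚᵘ.+ q))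
  (ℚᵘ.≃-sym (ℚᵘ.≃-trans (ℚ.toℚᵘ-homo-+ (fromℚᵘ p) (fromℚᵘ q))
    (ℚᵘ.+-cong (ℚ.toℚᵘ-fromℚᵘ p) (ℚ.toℚᵘ-fromℚᵘ q)))))

/-*-/ : ∀ i j c d .{{_ : ℕ.NonZero c}} .{{_ : ℕ.NonZero d}} →
        _/_ (i ℤ.* j) (c ℕ.* d) {{ℕ.m*n≢0 c d}} ≡ (i / c) * (j / d)
-- With successor denominators each fraction is by definition `fromℚᵘ` of an unnormalised one.
/-*-/ i j (suc c) (suc d) = fromℚᵘ-homo-* (mkℚᵘ i c) (mkℚᵘ j d)

suc/1 : ∀ k → + suc k / 1 ≡ 1ℚ + + k / 1
suc/1 k = trans
  (ℚ.fromℚᵘ-cong {mkℚᵘ (+ suc k) 0} {mkℚᵘ (+ 1) 0 ℚᵘ.+ mkℚᵘ (+ k) 0}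
    (*≡* (cong (ℤ._* + 1) (sym (cong (λ i → + 1 ℤ.+ i) (ℤ.*-identityʳ (+ k)))))))
  (fromℚᵘ-homo-+ (mkℚᵘ (+ 1) 0) (mkℚᵘ (+ k) 0))

/2^-suc : ∀ n → + 1 /2^ suc n ≡ ½ * (+ 1 /2^ n)
/2^-suc n = /-*-/ (+ 1) (+ 1) 2 (2 ^ n) {{_}} {{ℕ.m^n≢0 2 n}}

/2^-scale : ∀ k n → + k /2^ n ≡ (+ 1 /2^ n) * (+ k / 1)
/2^-scale k n = trans
  (ℚ./-cong {{ℕ.m^n≢0 2 n}} {{ℕ.m*n≢0 (2 ^ n) 1 {{ℕ.m^n≢0 2 n}}}}
    (sym (ℤ.*-identityˡ (+ k))) (sym (ℕ.*-identityʳ (2 ^ n))))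
  (/-*-/ (+ 1) (+ k) (2 ^ n) 1 {{ℕ.m^n≢0 2 n}})

0≤/2^ : ∀ n → 0ℚ ≤ + 1 /2^ n
0≤/2^ zero    = ℚ.nonNegative⁻¹ 1ℚ
0≤/2^ (suc n) = begin
  0ℚ                ≡⟨ ℚ.*-zeroʳ ½ ⟨
  ½ * 0ℚ            ≤⟨ ℚ.*-monoˡ-≤-nonNeg ½ (0≤/2^ n) ⟩
  ½ * (+ 1 /2^ n)   ≡⟨ /2^-suc n ⟨
  + 1 /2^ suc n     ∎
  where open ≤-Reasoning

0≤p*p : ∀ p → 0ℚ ≤ p * p
0≤p*p p with ℚ.≤-total 0ℚ p
... | inj₁ 0≤p = ≤-trans (≤-reflexive (sym (ℚ.*-zeroʳ p)))
  (ℚ.*-monoˡ-≤-nonNeg p {{nonNegative 0≤p}} 0≤p)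
... | inj₂ p≤0 = ≤-trans (≤-reflexive (sym (ℚ.*-zeroʳ p)))
  (ℚ.*-monoˡ-≤-nonPos p {{nonPositive p≤0}} p≤0)

-- Finite sums over lists and filtered lists.

sum-map-cong : {g h : A → ℚ} → (∀ x → g x ≡ h x) →
               ∀ xs → sum (map g xs) ≡ sum (map h xs)
sum-map-cong eq []       = refl
sum-map-cong eq (x ∷ xs) = cong₂ _+_ (eq x) (sum-map-cong eq xs)

sum-map-mono : {g h : A → ℚ} → (∀ x → g x ≤ h x) →
               ∀ xs → sum (map g xs) ≤ sum (map h xs)
sum-map-mono le []       = ≤-refl
sum-map-mono le (x ∷ xs) = +-mono-≤ (le x) (sum-map-mono le xs)

sum-map-+ : ∀ (g h : A → ℚ) xs →
            sum (map (λ x → g x + h x) xs) ≡ sum (map g xs) + sum (map h xs)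
sum-map-+ g h []       = refl
sum-map-+ g h (x ∷ xs) = trans (cong (_+_ (g x + h x)) (sum-map-+ g h xs))
  (solve 4 (λ a b c d → (a :+ b) :+ (c :+ d) := (a :+ c) :+ (b :+ d)) refl
    (g x) (h x) (sum (map g xs)) (sum (map h xs)))

sum-map-* : ∀ c (g : A → ℚ) xs →
            sum (map (λ x → c * g x) xs) ≡ c * sum (map g xs)
sum-map-* c g []       = sym (ℚ.*-zeroʳ c)
sum-map-* c g (x ∷ xs) =
  trans (cong (_+_ (c * g x)) (sum-map-* c g xs)) (sym (ℚ.*-distribˡ-+ c _ _))

sum-map-++ : ∀ (g : A → ℚ) xs ys →
             sum (map g (xs ++ ys)) ≡ sum (map g xs) + sum (map g ys)
sum-map-++ g []       ys = sym (ℚ.+-identityˡ _)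
sum-map-++ g (x ∷ xs) ys =
  trans (cong (_+_ (g x)) (sum-map-++ g xs ys)) (sym (ℚ.+-assoc (g x) _ _))

-- Splitting by the first entry drives every induction on the dimension, for points of the cube and
-- for subsets alike.
sum-vectors-suc : ∀ (a b : A) n (g : Vec A (suc n) → ℚ) →
  let vs = vectors (a ∷ b ∷ []) n in
  sum (map g (vectors (a ∷ b ∷ []) (suc n))) ≡
  sum (map (g ∘ (a Vec.∷_)) vs) + sum (map (g ∘ (b Vec.∷_)) vs)
sum-vectors-suc a b n g = begin
  -- The product with a two-element list unfolds to two blocks followed by an empty one.
  sum (map g (as ++ bs ++ []))            ≡⟨ cong (λ xs → sum (map g (as ++ xs))) (++-identityʳ bs) ⟩
  sum (map g (as ++ bs))                  ≡⟨ sum-map-++ g as bs ⟩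
  sum (map g as) + sum (map g bs)         ≡⟨ cong₂ (λ xs ys → sum xs + sum ys) (map-∘ vs) (map-∘ vs) ⟨
  _ ∎
  where
  open ≡-Reasoning
  vs = vectors (a ∷ b ∷ []) n
  as = map (a Vec.∷_) vs
  bs = map (b Vec.∷_) vs

module _ {P : A → Set} (P? : Decidable P) where

  sum-filter-cong : {g h : A → ℚ} → (∀ x → P x → g x ≡ h x) →
    ∀ xs → sum (map g (filter P? xs)) ≡ sum (map h (filter P? xs))
  sum-filter-cong eq []       = refl
  sum-filter-cong eq (x ∷ xs) with P? x
  ... | yes px = cong₂ _+_ (eq x px) (sum-filter-cong eq xs)
  ... | no _   = sum-filter-cong eq xs

  module _ {g : A → ℚ} (0≤g : ∀ x → 0ℚ ≤ g x) where

    sum-filter-≤ : ∀ xs → sum (map g (filter P? xs)) ≤ sum (map g xs)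
    sum-filter-≤ []       = ≤-refl
    sum-filter-≤ (x ∷ xs) with P? x
    ... | yes _ = ℚ.+-monoʳ-≤ (g x) (sum-filter-≤ xs)
    ... | no  _ = ≤-trans (≤-reflexive (sym (ℚ.+-identityˡ _)))
                          (+-mono-≤ (0≤g x) (sum-filter-≤ xs))

    -- As `x` fails `P`, its term is absent from the filtered sum and can be counted beside it; the
    -- remaining discarded terms are nonnegative. This sets the empty set apart from a level of
    -- positive degree.
    x+sum-filter-≤ : ∀ {x xs} → ¬ P x → x ∈ xs →
                     g x + sum (map g (filter P? xs)) ≤ sum (map g xs)
    x+sum-filter-≤ {x} {xs = _ ∷ xs} ¬px (here refl) with P? x
    ... | yes px = contradiction px ¬px
    ... | no  _  = ℚ.+-monoʳ-≤ (g x) (sum-filter-≤ xs)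
    x+sum-filter-≤ {x} {xs = y ∷ xs} ¬px (there x∈xs) with P? y
    ... | yes _ = begin
      g x + (g y + s)  ≡⟨ solve 3 (λ a b c → a :+ (b :+ c) := b :+ (a :+ c)) refl (g x) (g y) s ⟩
      g y + (g x + s)  ≤⟨ ℚ.+-monoʳ-≤ (g y) (x+sum-filter-≤ ¬px x∈xs) ⟩
      _ ∎
      where
      open ≤-Reasoning
      s = sum (map g (filter P? xs))
    ... | no  _ = ≤-trans (≤-reflexive (sym (ℚ.+-identityˡ _)))
                          (+-mono-≤ (0≤g y) (x+sum-filter-≤ ¬px x∈xs))

-- Expectation over the cube.

𝔼-cong : {g h : Vec Sign n → ℚ} → (∀ x → g x ≡ h x) → 𝔼 g ≡ 𝔼 h
𝔼-cong {n} eq = cong ((+ 1 /2^ n) *_) (sum-map-cong eq (cube n))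

𝔼-mono : {g h : Vec Sign n → ℚ} → (∀ x → g x ≤ h x) → 𝔼 g ≤ 𝔼 h
𝔼-mono {n} le = ℚ.*-monoˡ-≤-nonNeg (+ 1 /2^ n) {{nonNegative (0≤/2^ n)}}
  (sum-map-mono le (cube n))

𝔼-+ : ∀ (g h : Vec Sign n → ℚ) → 𝔼 (λ x → g x + h x) ≡ 𝔼 g + 𝔼 h
𝔼-+ {n} g h = trans (cong ((+ 1 /2^ n) *_) (sum-map-+ g h (cube n)))
  (ℚ.*-distribˡ-+ (+ 1 /2^ n) _ _)

𝔼-* : ∀ c (g : Vec Sign n → ℚ) → 𝔼 (λ x → c * g x) ≡ c * 𝔼 g
𝔼-* {n} c g = trans (cong ((+ 1 /2^ n) *_) (sum-map-* c g (cube n)))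
  (solve 3 (λ e c s → e :* (c :* s) := c :* (e :* s)) refl (+ 1 /2^ n) c _)

-- Averaging over the first coordinate. The factor `½` sits inside, so that the right side is again
-- the expectation of one function and an induction hypothesis for arbitrary functions applies to
-- it.
𝔼-suc : ∀ (g : Vec Sign (suc n) → ℚ) →
        𝔼 g ≡ 𝔼 (λ x → ½ * (g (Sign.+ Vec.∷ x) + g (Sign.- Vec.∷ x)))
𝔼-suc {n} g = begin
  𝔼 g
    ≡⟨ cong₂ _*_ (/2^-suc n) (sum-vectors-suc Sign.+ Sign.- n g) ⟩
  ½ * (+ 1 /2^ n) * (s₁ + s₂)
    ≡⟨ solve 4 (λ h e s t → h :* e :* (s :+ t) := h :* (e :* s :+ e :* t)) refl
         ½ (+ 1 /2^ n) s₁ s₂ ⟩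
  ½ * (𝔼 g₊ + 𝔼 g₋)
    ≡⟨ cong (½ *_) (𝔼-+ g₊ g₋) ⟨
  ½ * 𝔼 (λ x → g₊ x + g₋ x)
    ≡⟨ 𝔼-* ½ (λ x → g₊ x + g₋ x) ⟨
  𝔼 (λ x → ½ * (g₊ x + g₋ x)) ∎
  where
  open ≡-Reasoning
  g₊ g₋ : Vec Sign n → ℚ
  g₊ x = g (Sign.+ Vec.∷ x)
  g₋ x = g (Sign.- Vec.∷ x)
  s₁ s₂ : ℚ
  s₁ = sum (map g₊ (cube n))
  s₂ = sum (map g₋ (cube n))

𝔼-const : ∀ n c → 𝔼 {n} (λ _ → c) ≡ c
𝔼-const zero    c = solve 1 (λ c → con 1ℚ :* (c :+ con 0ℚ) := c) refl c
𝔼-const (suc n) c = begin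
  𝔼 {suc n} (λ _ → c)          ≡⟨ 𝔼-suc {n} (λ _ → c) ⟩
  𝔼 {n} (λ _ → ½ * (c + c))    ≡⟨ 𝔼-const n (½ * (c + c)) ⟩
  ½ * (c + c)                  ≡⟨ solve 1 (λ c → con ½ :* (c :+ c) := c) refl c ⟩
  c                            ∎
  where open ≡-Reasoning

-- Antipodal symmetry.

antipode : Vec Sign n → Vec Sign n
antipode = Vec.map opposite

-- Negating the first coordinate swaps the two halves of the cube, which commutativity of `_+_`
-- absorbs; the other coordinates are handled by induction on the averaged function. No permutation
-- of `cube n` is needed.
𝔼-antipode : ∀ (g : Vec Sign n → ℚ) → 𝔼 (g ∘ antipode) ≡ 𝔼 g
𝔼-antipode {zero}  g = refl
𝔼-antipode {suc n} g = begin
  𝔼 (g ∘ antipode)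
    ≡⟨ 𝔼-suc (g ∘ antipode) ⟩
  𝔼 (λ x → ½ * (g (Sign.- Vec.∷ antipode x) + g (Sign.+ Vec.∷ antipode x)))
    ≡⟨ 𝔼-antipode (λ x → ½ * (g (Sign.- Vec.∷ x) + g (Sign.+ Vec.∷ x))) ⟩
  𝔼 (λ x → ½ * (g (Sign.- Vec.∷ x) + g (Sign.+ Vec.∷ x)))
    ≡⟨ 𝔼-cong (λ x → cong (½ *_) (ℚ.+-comm (g (Sign.- Vec.∷ x)) _)) ⟩
  𝔼 (λ x → ½ * (g (Sign.+ Vec.∷ x) + g (Sign.- Vec.∷ x)))
    ≡⟨ 𝔼-suc g ⟨
  𝔼 g ∎
  where open ≡-Reasoning

-- Characters: peeling off the first coordinate, and parity.

map-filter-∷ : ∀ b (S : Subset n) (g : _ → A) is →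
  map g (filter (_∈? (b Vec.∷ S)) (map suc is)) ≡ map (g ∘ suc) (filter (_∈? S) is)
map-filter-∷ b S g []       = refl
-- Membership of `suc i` in `b ∷ S` is decided through `i ∈? S`, so one case split settles both
-- filters.
map-filter-∷ b S g (i ∷ is) with i ∈? S
... | yes _ = cong (g (suc i) ∷_) (map-filter-∷ b S g is)
... | no  _ = map-filter-∷ b S g is

-- `allFin (suc n)` unfolds to `zero` followed by `tabulate suc`; the latter indices see only the
-- tails of the set and of the point.
χ-tail : ∀ b (S : Subset n) s x →
  product (map (λ i → ⟦ lookup (s Vec.∷ x) i ⟧)
               (filter (_∈? (b Vec.∷ S)) (tabulate suc))) ≡ χ S x
χ-tail {n} b S s x = cong product (trans
  (cong (λ is → map g (filter (_∈? (b Vec.∷ S)) is)) (sym (map-tabulate id suc)))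
  (map-filter-∷ b S g (allFin n)))
  where
  g = λ i → ⟦ lookup (s Vec.∷ x) i ⟧

χ-inside : ∀ (S : Subset n) s x → χ (true Vec.∷ S) (s Vec.∷ x) ≡ ⟦ s ⟧ * χ S x
χ-inside S s x = cong (⟦ s ⟧ *_) (χ-tail true S s x)

χ-outside : ∀ (S : Subset n) s x → χ (false Vec.∷ S) (s Vec.∷ x) ≡ χ S x
χ-outside = χ-tail false

χ-⊥ : ∀ (x : Vec Sign n) → χ ⊥ x ≡ 1ℚ
χ-⊥ Vec.[]      = refl
χ-⊥ (s Vec.∷ x) = trans (χ-outside ⊥ s x) (χ-⊥ x)

-- The sign (-1)^k.
alt : ℕ → ℚ
alt zero    = 1ℚ
alt (suc k) = - alt k

alt-odd : ∀ k → ¬ 2 ∣ k → alt k ≡ - 1ℚ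
alt-odd zero          2∤k = contradiction (2 ∣0) 2∤k
alt-odd (suc zero)    2∤k = refl
alt-odd (suc (suc k)) 2∤k =
  trans (solve 1 (λ a → :- (:- a) := a) refl (alt k)) (alt-odd k (2∤k ∘ ∣m∣n⇒∣m+n ∣-refl))

⟦opposite⟧ : ∀ s → ⟦ opposite s ⟧ ≡ - ⟦ s ⟧
⟦opposite⟧ Sign.+ = refl
⟦opposite⟧ Sign.- = refl

-- Each index in `S` contributes one factor -1.
χ-antipode : ∀ (S : Subset n) x → χ S (antipode x) ≡ alt ∣ S ∣ * χ S x
χ-antipode Vec.[] Vec.[] = refl
χ-antipode (true Vec.∷ S) (s Vec.∷ x) = begin
  χ (true Vec.∷ S) (antipode (s Vec.∷ x))      ≡⟨ χ-inside S (opposite s) (antipode x) ⟩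
  ⟦ opposite s ⟧ * χ S (antipode x)            ≡⟨ cong₂ _*_ (⟦opposite⟧ s) (χ-antipode S x) ⟩
  - ⟦ s ⟧ * (alt ∣ S ∣ * χ S x)
    ≡⟨ solve 3 (λ s a c → :- s :* (a :* c) := :- a :* (s :* c)) refl ⟦ s ⟧ (alt ∣ S ∣) (χ S x) ⟩
  - alt ∣ S ∣ * (⟦ s ⟧ * χ S x)                ≡⟨ cong (_*_ (- alt ∣ S ∣)) (χ-inside S s x) ⟨
  - alt ∣ S ∣ * χ (true Vec.∷ S) (s Vec.∷ x)   ∎
  where open ≡-Reasoning
χ-antipode (false Vec.∷ S) (s Vec.∷ x) = begin
  χ (false Vec.∷ S) (antipode (s Vec.∷ x))   ≡⟨ χ-outside S (opposite s) (antipode x) ⟩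
  χ S (antipode x)                           ≡⟨ χ-antipode S x ⟩
  alt ∣ S ∣ * χ S x                          ≡⟨ cong (alt ∣ S ∣ *_) (χ-outside S s x) ⟨
  alt ∣ S ∣ * χ (false Vec.∷ S) (s Vec.∷ x)  ∎
  where open ≡-Reasoning

-- Fourier coefficients of rational-valued functions and Parseval's identity.

coefficient : (Vec Sign n → ℚ) → Subset n → ℚ
coefficient h S = 𝔼 λ x → h x * χ S x

-- Rational values are allowed because half-sums and differences of sign functions leave ±1. At
-- `λ x → ⟦ f x ⟧` this is by definition the summand of `W`.
weight : (Vec Sign n → ℚ) → Subset n → ℚ
weight h S = coefficient h S * coefficient h S

-- The character changes sign with the first coordinate, so only the half-difference of the two
-- restrictions of `h` survives.
coefficient-inside : ∀ (h : Vec Sign (suc n) → ℚ) S →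
  coefficient h (true Vec.∷ S) ≡
  coefficient (λ x → ½ * (h (Sign.+ Vec.∷ x) - h (Sign.- Vec.∷ x))) S
coefficient-inside h S = trans (𝔼-suc (λ x → h x * χ (true Vec.∷ S) x))
  (𝔼-cong λ x → trans
    (cong₂ (λ p q → ½ * (h (Sign.+ Vec.∷ x) * p + h (Sign.- Vec.∷ x) * q))
      (χ-inside S Sign.+ x) (χ-inside S Sign.- x))
    (solve 3 (λ p q c → con ½ :* (p :* (con 1ℚ :* c) :+ q :* (con (- 1ℚ) :* c))
                        := con ½ :* (p :- q) :* c) refl
      (h (Sign.+ Vec.∷ x)) (h (Sign.- Vec.∷ x)) (χ S x)))

-- The character ignores the first coordinate, which leaves the mean of the two restrictions.
coefficient-outside : ∀ (h : Vec Sign (suc n) → ℚ) S →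
  coefficient h (false Vec.∷ S) ≡
  coefficient (λ x → ½ * (h (Sign.+ Vec.∷ x) + h (Sign.- Vec.∷ x))) S
coefficient-outside h S = trans (𝔼-suc (λ x → h x * χ (false Vec.∷ S) x))
  (𝔼-cong λ x → trans
    (cong₂ (λ p q → ½ * (h (Sign.+ Vec.∷ x) * p + h (Sign.- Vec.∷ x) * q))
      (χ-outside S Sign.+ x) (χ-outside S Sign.- x))
    (solve 3 (λ p q c → con ½ :* (p :* c :+ q :* c) := con ½ :* (p :+ q) :* c) refl
      (h (Sign.+ Vec.∷ x)) (h (Sign.- Vec.∷ x)) (χ S x)))

-- Induction on the dimension takes the place of orthogonality of characters: subsets with and
-- without the first index carry the weights of the half-difference `d` and the half-sum `e`.
parseval : ∀ (h : Vec Sign n → ℚ) →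
           sum (map (weight h) (subsets n)) ≡ 𝔼 (λ x → h x * h x)
parseval {zero}  h =
  -- One point and one subset remain; `c` is the unfolded coefficient.
  solve 1 (λ p → let c = con 1ℚ :* (p :* con 1ℚ :+ con 0ℚ) in
                 c :* c :+ con 0ℚ := con 1ℚ :* (p :* p :+ con 0ℚ)) refl (h Vec.[])
parseval {suc n} h = begin
  sum (map (weight h) (subsets (suc n)))
    ≡⟨ sum-vectors-suc true false n (weight h) ⟩
  sum (map (λ S → weight h (true Vec.∷ S)) (subsets n)) +
  sum (map (λ S → weight h (false Vec.∷ S)) (subsets n))
    ≡⟨ cong₂ _+_
         (sum-map-cong (λ S → cong (λ c → c * c) (coefficient-inside h S)) (subsets n))
         (sum-map-cong (λ S → cong (λ c → c * c) (coefficient-outside h S)) (subsets n)) ⟩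
  sum (map (weight d) (subsets n)) + sum (map (weight e) (subsets n))
    ≡⟨ cong₂ _+_ (parseval d) (parseval e) ⟩
  𝔼 (λ x → d x * d x) + 𝔼 (λ x → e x * e x)
    ≡⟨ 𝔼-+ (λ x → d x * d x) (λ x → e x * e x) ⟨
  𝔼 (λ x → d x * d x + e x * e x)
    -- The parallelogram law for the two restrictions.
    ≡⟨ 𝔼-cong (λ x → solve 2
         (λ p q → con ½ :* (p :- q) :* (con ½ :* (p :- q)) :+ con ½ :* (p :+ q) :* (con ½ :* (p :+ q))
                  := con ½ :* (p :* p :+ q :* q)) refl
         (h (Sign.+ Vec.∷ x)) (h (Sign.- Vec.∷ x))) ⟩
  𝔼 (λ x → ½ * (h (Sign.+ Vec.∷ x) * h (Sign.+ Vec.∷ x) + h (Sign.- Vec.∷ x) * h (Sign.- Vec.∷ x)))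
    ≡⟨ 𝔼-suc (λ x → h x * h x) ⟨
  𝔼 (λ x → h x * h x) ∎
  where
  open ≡-Reasoning
  d e : Vec Sign n → ℚ
  d x = ½ * (h (Sign.+ Vec.∷ x) - h (Sign.- Vec.∷ x))
  e x = ½ * (h (Sign.+ Vec.∷ x) + h (Sign.- Vec.∷ x))

-- Sign values and counting.

sum-1+⟦⟧ : ∀ (f : A → Sign) xs →
  sum (map (λ x → 1ℚ + ⟦ f x ⟧) xs) ≡ 2ℚ * (+ length (filter (λ x → f x ≟ Sign.+) xs) / 1)
sum-1+⟦⟧ f []       = refl
sum-1+⟦⟧ f (x ∷ xs) with f x
-- `1ℚ + ⟦ s ⟧` is twice the indicator of `s` being `+`: a negative value adds 0, a positive one
-- adds 2.
... | Sign.- = trans (ℚ.+-identityˡ _) (sum-1+⟦⟧ f xs)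
... | Sign.+ = begin
  2ℚ + sum (map (λ x → 1ℚ + ⟦ f x ⟧) xs)   ≡⟨ cong (_+_ 2ℚ) (sum-1+⟦⟧ f xs) ⟩
  2ℚ + 2ℚ * (+ k / 1)
    ≡⟨ solve 1 (λ k → con 2ℚ :+ con 2ℚ :* k := con 2ℚ :* (con 1ℚ :+ k)) refl (+ k / 1) ⟩
  2ℚ * (1ℚ + + k / 1)                      ≡⟨ cong (2ℚ *_) (suc/1 k) ⟨
  2ℚ * (+ suc k / 1)                       ∎
  where
  open ≡-Reasoning
  k = length (filter (λ x → f x ≟ Sign.+) xs)

⟦⟧-square : ∀ s → ⟦ s ⟧ * ⟦ s ⟧ ≡ 1ℚ
⟦⟧-square Sign.+ = refl
⟦⟧-square Sign.- = refl

-- Equality holds in every case except two positive signs, where the claim is 0 ≤ 8.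
⟦⟧-difference-square : ∀ s t →
  (⟦ s ⟧ - ⟦ t ⟧) * (⟦ s ⟧ - ⟦ t ⟧) ≤ 2ℚ * ((1ℚ + ⟦ s ⟧) + (1ℚ + ⟦ t ⟧))
⟦⟧-difference-square Sign.+ Sign.+ = ℚ.nonNegative⁻¹ (+ 8 / 1)
⟦⟧-difference-square Sign.+ Sign.- = ≤-refl
⟦⟧-difference-square Sign.- Sign.+ = ≤-refl
⟦⟧-difference-square Sign.- Sign.- = ≤-refl

-- The bounds on the Fourier weights.

module _ (f : Vec Sign n → Sign) where

  density : ℚ
  density = + ∣ f ⁻¹⟨1⟩∣ /2^ n

  𝔼-1+⟦f⟧ : 𝔼 (λ x → 1ℚ + ⟦ f x ⟧) ≡ 2ℚ * density
  𝔼-1+⟦f⟧ = begin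
    (+ 1 /2^ n) * sum (map (λ x → 1ℚ + ⟦ f x ⟧) (cube n))
      ≡⟨ cong ((+ 1 /2^ n) *_) (sum-1+⟦⟧ f (cube n)) ⟩
    (+ 1 /2^ n) * (2ℚ * (+ ∣ f ⁻¹⟨1⟩∣ / 1))
      ≡⟨ solve 2 (λ e k → e :* (con 2ℚ :* k) := con 2ℚ :* (e :* k)) refl
           (+ 1 /2^ n) (+ ∣ f ⁻¹⟨1⟩∣ / 1) ⟩
    2ℚ * ((+ 1 /2^ n) * (+ ∣ f ⁻¹⟨1⟩∣ / 1))
      ≡⟨ cong (2ℚ *_) (/2^-scale ∣ f ⁻¹⟨1⟩∣ n) ⟨
    2ℚ * density ∎
    where open ≡-Reasoning

  fourier-⊥ : fourier f ⊥ ≡ 2ℚ * density - 1ℚ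
  fourier-⊥ = begin
    𝔼 (λ x → ⟦ f x ⟧ * χ ⊥ x)
      ≡⟨ 𝔼-cong (λ x → trans (cong (⟦ f x ⟧ *_) (χ-⊥ x))
           -- Splitting off -1 exposes `1ℚ + ⟦ f x ⟧`, whose mean is known by counting.
           (solve 1 (λ s → s :* con 1ℚ := (con 1ℚ :+ s) :+ con (- 1ℚ)) refl ⟦ f x ⟧)) ⟩
    𝔼 (λ x → (1ℚ + ⟦ f x ⟧) + - 1ℚ)
      ≡⟨ 𝔼-+ (λ x → 1ℚ + ⟦ f x ⟧) (λ _ → - 1ℚ) ⟩
    𝔼 (λ x → 1ℚ + ⟦ f x ⟧) + 𝔼 {n} (λ _ → - 1ℚ)
      ≡⟨ cong₂ _+_ 𝔼-1+⟦f⟧ (𝔼-const n (- 1ℚ)) ⟩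
    2ℚ * density - 1ℚ ∎
    where open ≡-Reasoning

  W-≤-variance : ∀ m → m ≢ 0 → W m f ≤ 4ℚ * density * (1ℚ - density)
  W-≤-variance m m≢0 = begin
    W m f
      -- The squared mean is added and subtracted, so that Parseval's total bounds it together with
      -- level `m`; `m ≢ 0` keeps the empty set out of that level.
      ≡⟨ solve 2 (λ w r → w := (r :+ w) :- r) refl (W m f) (fourier f ⊥ * fourier f ⊥) ⟩
    (fourier f ⊥ * fourier f ⊥ + W m f) - fourier f ⊥ * fourier f ⊥
      ≤⟨ ℚ.+-monoˡ-≤ (- (fourier f ⊥ * fourier f ⊥))
           (x+sum-filter-≤ (λ S → ∣ S ∣ ℕ.≟ m) (λ S → 0≤p*p (fourier f S))
             (λ ∣⊥∣≡m → m≢0 (trans (sym ∣⊥∣≡m) (∣⊥∣≡0 n))) (subsets-complete (⊥ {n}))) ⟩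
    sum (map (weight (λ x → ⟦ f x ⟧)) (subsets n)) - fourier f ⊥ * fourier f ⊥
      ≡⟨ cong₂ (λ p r → p - r * r) (parseval (λ x → ⟦ f x ⟧)) fourier-⊥ ⟩
    𝔼 (λ x → ⟦ f x ⟧ * ⟦ f x ⟧) - (2ℚ * density - 1ℚ) * (2ℚ * density - 1ℚ)
      ≡⟨ cong (λ p → p - (2ℚ * density - 1ℚ) * (2ℚ * density - 1ℚ))
           (trans (𝔼-cong (λ x → ⟦⟧-square (f x))) (𝔼-const n 1ℚ)) ⟩
    1ℚ - (2ℚ * density - 1ℚ) * (2ℚ * density - 1ℚ)
      ≡⟨ solve 1 (λ a → con 1ℚ :- (con 2ℚ :* a :- con 1ℚ) :* (con 2ℚ :* a :- con 1ℚ)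
                        := con 4ℚ :* a :* (con 1ℚ :- a)) refl density ⟩
    4ℚ * density * (1ℚ - density) ∎
    where open ≤-Reasoning

  -- Twice the odd part of `f`.
  oddDifference : Vec Sign n → ℚ
  oddDifference x = ⟦ f x ⟧ - ⟦ f (antipode x) ⟧

  -- The subtracted term becomes a second copy of `fourier f S`: its minus sign is the sign that an
  -- odd character picks up at the antipode, and the expectation is antipodally invariant.
  coefficient-oddDifference : ∀ S → ¬ 2 ∣ ∣ S ∣ → coefficient oddDifference S ≡ 2ℚ * fourier f S
  coefficient-oddDifference S 2∤∣S∣ = begin
    𝔼 (λ x → (⟦ f x ⟧ - ⟦ f (antipode x) ⟧) * χ S x)
      ≡⟨ 𝔼-cong (λ x → trans
           (solve 3 (λ p q c → (p :- q) :* c := p :* c :+ q :* (con (- 1ℚ) :* c)) refl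
             ⟦ f x ⟧ ⟦ f (antipode x) ⟧ (χ S x))
           (cong (λ c → ⟦ f x ⟧ * χ S x + ⟦ f (antipode x) ⟧ * c) (sym (χ-odd x)))) ⟩
    𝔼 (λ x → g x + g (antipode x))
      ≡⟨ 𝔼-+ g (g ∘ antipode) ⟩
    𝔼 g + 𝔼 (g ∘ antipode)
      ≡⟨ cong (_+_ (𝔼 g)) (𝔼-antipode g) ⟩
    𝔼 g + 𝔼 g
      ≡⟨ solve 1 (λ p → p :+ p := con 2ℚ :* p) refl (𝔼 g) ⟩
    2ℚ * 𝔼 g ∎
    where
    open ≡-Reasoning
    g : Vec Sign n → ℚ
    g x = ⟦ f x ⟧ * χ S x
    χ-odd : ∀ x → χ S (antipode x) ≡ - 1ℚ * χ S x
    χ-odd x = trans (χ-antipode S x) (cong (_* χ S x) (alt-odd ∣ S ∣ 2∤∣S∣))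

  W-odd-≤ : ∀ m → ¬ 2 ∣ m → W m f ≤ 2ℚ * density
  -- The factor 4 is the square of the 2 in `coefficient-oddDifference`; it cancels at the end.
  W-odd-≤ m 2∤m = ℚ.*-cancelˡ-≤-pos 4ℚ (begin
    4ℚ * W m f
      ≡⟨ sum-map-* 4ℚ (weight (λ x → ⟦ f x ⟧)) Ss ⟨
    sum (map (λ S → 4ℚ * weight (λ x → ⟦ f x ⟧) S) Ss)
      -- Inside the filter `∣ S ∣ ≡ m` is available, so `S` inherits odd size from `m`.
      ≡⟨ sum-filter-cong (λ S → ∣ S ∣ ℕ.≟ m) (λ S ∣S∣≡m → trans
           (solve 1 (λ c → con 4ℚ :* (c :* c) := con 2ℚ :* c :* (con 2ℚ :* c)) refl (fourier f S))
           (cong (λ c → c * c) (sym (coefficient-oddDifference S (2∤m ∘ subst (2 ∣_) ∣S∣≡m))))) (subsets n) ⟩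
    sum (map (weight oddDifference) Ss)
      ≤⟨ sum-filter-≤ (λ S → ∣ S ∣ ℕ.≟ m) (λ S → 0≤p*p (coefficient oddDifference S)) (subsets n) ⟩
    sum (map (weight oddDifference) (subsets n))
      ≡⟨ parseval oddDifference ⟩
    𝔼 (λ x → oddDifference x * oddDifference x)
      ≤⟨ 𝔼-mono (λ x → ⟦⟧-difference-square (f x) (f (antipode x))) ⟩
    𝔼 (λ x → 2ℚ * (g x + g (antipode x)))
      ≡⟨ 𝔼-* 2ℚ (λ x → g x + g (antipode x)) ⟩
    2ℚ * 𝔼 (λ x → g x + g (antipode x))
      ≡⟨ cong (2ℚ *_) (𝔼-+ g (g ∘ antipode)) ⟩
    2ℚ * (𝔼 g + 𝔼 (g ∘ antipode))
      ≡⟨ cong (λ e → 2ℚ * (𝔼 g + e)) (𝔼-antipode g) ⟩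
    2ℚ * (𝔼 g + 𝔼 g)
      ≡⟨ cong (λ e → 2ℚ * (e + e)) 𝔼-1+⟦f⟧ ⟩
    2ℚ * (2ℚ * density + 2ℚ * density)
      ≡⟨ solve 1 (λ a → con 2ℚ :* (con 2ℚ :* a :+ con 2ℚ :* a) := con 4ℚ :* (con 2ℚ :* a))
           refl density ⟩
    4ℚ * (2ℚ * density) ∎)
    where
    open ≤-Reasoning
    Ss = filter (λ S → ∣ S ∣ ℕ.≟ m) (subsets n)
    g : Vec Sign n → ℚ
    g x = 1ℚ + ⟦ f x ⟧

theorem3 : ∀ (n M : ℕ) → 1 ℕ.≤ n → 1 ℕ.≤ M → M ℕ.≤ 2 ^ (n ∸ 1) →
    ∀ (f : Vec Sign n → Sign) → ∣ f ⁻¹⟨1⟩∣ ≡ M →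
    let a = + M /2^ n in
    (∀ (m : ℕ) → 2 ∣ m → 2 ℕ.≤ m → m ℕ.≤ n →
    W m f ≤ (+ 4 / 1) * a * (1ℚ - a))
    ×
    (∀ (m : ℕ) → ¬ (2 ∣ m) → 3 ℕ.≤ m → m ℕ.≤ n →
    W m f ≤ (+ 2 / 1) * a)
-- Matching on `refl` turns `a` into `density f`.
theorem3 n M _ _ _ f refl =
  (λ m _ 2≤m _ → W-≤-variance f m (ℕ.m<n⇒n≢0 2≤m)) ,
  (λ m 2∤m _ _ → W-odd-≤ f m 2∤m)
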